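{- The structure $(\mathbb{Q}^+,\times)$ of positive rational numbers under multiplication (equivalently, the free Abelian group of rank $\omega$) is not FA presentable.
   Context: For $\diamond\notin\Sigma$, the convolution $\otimes(w_1,\dots,w_n)$ of a tuple of words over a finite alphabet $\Sigma$ is the word of length $\max_i|w_i|$ over $(\Sigma\cup\{\diamond\})^n$ whose $k$-th symbol is $(\sigma_1,\dots,\sigma_n)$, where $\sigma_i$ is the $k$-th symbol of $w_i$ if $k\le|w_i|$ and $\sigma_i=\diamond$ otherwise. A relation $R\subseteq(\Sigma^\star)^n$ is FA recognisable if $\{\otimes w: w\in R\}$ is a regular language. A structure is FA presentable (has an automatic presentation) if it is isomorphic to a structure whose domain is a regular subset of $\Sigma^\star$ for some finite alphabet $\Sigma$ and whose atomic relations (operations being replaced by their graphs) are FA recognisable. (This is not the notion of "automatic group" from combinatorial group theory.) -}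

module Defs where

open import Algebra.Bundles using (Magma)
open import Data.Fin.Base using (Fin)
open import Data.Fin.Subset using (Subset; _∈_)
open import Data.List.Base using (List; applyUpTo; drop; foldl; head; length)
open import Data.Maybe.Base using (Maybe)
open import Data.Nat.Base as ℕ using (ℕ)
open import Data.Product.Base using (Σ; ∃-syntax; _×_; _,_; proj₁)
open import Data.Rational.Base as ℚ using (ℚ)
import Data.Rational.Properties as ℚ
open import Data.Unit.Base using (⊤)
open import Data.Vec.Base as Vec using (Vec; []; _∷_)
open import Data.Vec.Relation.Binary.Pointwise.Inductive using (Pointwise; []; _∷_)
open import Data.Vec.Relation.Unary.All using (All)
open import Function.Bundles using (Bijection; _⇔_)
open import Level using (Level; 0ℓ; _⊔_; suc)
open import Relation.Binary.Bundles using (Setoid)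
import Relation.Binary.Construct.On as On
open import Relation.Binary.PropositionalEquality using (_≡_; refl; cong₂; setoid; subst)
open import Relation.Unary using (Pred; _⊆_)

private
  variable
    c c₁ c₂ ℓ ℓ₁ ℓ₂ r r₁ r₂ : Level

record DFA (A : Set) : Set where
  field
    states : ℕ
    start  : Fin states
    step   : Fin states → A → Fin states
    final  : Subset states

  Accepts : Pred (List A) 0ℓ
  Accepts w = foldl step start w ∈ final

Regular : {A : Set} → Pred (List A) ℓ → Set ℓ
Regular {A = A} L = ∃[ M ] (∀ w → L w ⇔ DFA.Accepts {A} M w)

-- `nothing` plays the role of the padding symbol ⋄; positions count from 0.
module _ {A : Set} where

  symbolAt : ℕ → List A → Maybe A
  symbolAt k w = head (drop k w)

  maxLength : ∀ {n} → Vec (List A) n → ℕ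
  maxLength ws = Vec.foldr′ ℕ._⊔_ 0 (Vec.map length ws)

  ⊗ : ∀ {n} → Vec (List A) n → List (Vec (Maybe A) n)
  ⊗ ws = applyUpTo (λ k → Vec.map (symbolAt k) ws) (maxLength ws)

  FARecognisable : ∀ {n} → Pred (Vec (List A) n) ℓ → Set ℓ
  FARecognisable R = Regular (λ u → ∃[ ws ] (R ws × u ≡ ⊗ ws))

record Signature : Set₁ where
  field
    Symbol : Set
    arity  : Symbol → ℕ

open Signature

record Structure (S : Signature) c ℓ r : Set (suc (c ⊔ ℓ ⊔ r)) where
  field
    domain : Setoid c ℓ

  open Setoid domain public using (Carrier; _≈_)

  field
    rel      : ∀ s → Pred (Vec Carrier (arity S s)) r
    rel-resp : ∀ s {xs ys} → Pointwise _≈_ xs ys → rel s xs → rel s ys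

record _≅_ {S : Signature} (A : Structure S c₁ ℓ₁ r₁) (B : Structure S c₂ ℓ₂ r₂)
         : Set (c₁ ⊔ ℓ₁ ⊔ r₁ ⊔ c₂ ⊔ ℓ₂ ⊔ r₂) where
  private
    module A = Structure A
    module B = Structure B
  field
    bijection : Bijection A.domain B.domain

  open Bijection bijection public using (to)

  field
    rel-iff : ∀ s xs → A.rel s xs ⇔ B.rel s (Vec.map to xs)

-- The elements are the words in D; a word is the same element whatever
-- the proof that it belongs to D.
wordStructure : (S : Signature) {A : Set} (D : Pred (List A) 0ℓ) →
                (∀ s → Pred (Vec (List A) (arity S s)) 0ℓ) →
                Structure S 0ℓ 0ℓ 0ℓ
wordStructure S {A} D R = record
  { domain   = On.setoid {B = Σ (List A) D} (setoid (List A)) proj₁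
  ; rel      = λ s xs → R s (Vec.map proj₁ xs)
  ; rel-resp = λ s eqs → subst (R s) (map-proj₁ eqs)
  }
  where
  map-proj₁ : ∀ {n} {xs ys : Vec (Σ (List A) D) n} →
              Pointwise (λ x y → proj₁ x ≡ proj₁ y) xs ys →
              Vec.map proj₁ xs ≡ Vec.map proj₁ ys
  map-proj₁ []         = refl
  map-proj₁ (eq ∷ eqs) = cong₂ _∷_ eq (map-proj₁ eqs)

-- Since a regular language over a finite alphabet is equivalent to a
-- decidable one, no generality is lost by taking D and R at level 0ℓ.
record FAPresentable {S : Signature} (A : Structure S c ℓ r) : Set (suc 0ℓ ⊔ c ⊔ ℓ ⊔ r) where
  field
    alphabetSize : ℕ

  Word : Set
  Word = List (Fin alphabetSize)

  field
    D                : Pred Word 0ℓ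
    R                : ∀ s → Pred (Vec Word (arity S s)) 0ℓ
    R⊆D              : ∀ s → R s ⊆ All D
    D-regular        : Regular D
    R-FARecognisable : ∀ s → FARecognisable (R s)
    iso              : A ≅ wordStructure S D R

graphSignature : Signature
graphSignature = record { Symbol = ⊤ ; arity = λ _ → 3 }

graphStructure : Magma c ℓ → Structure graphSignature c ℓ ℓ
graphStructure M = record
  { domain   = M.setoid
  ; rel      = λ { _ (x ∷ y ∷ z ∷ []) → x M.∙ y M.≈ z }
  ; rel-resp = λ { _ (x≈x′ ∷ y≈y′ ∷ z≈z′ ∷ []) xy≈z →
                   M.trans (M.sym (M.∙-cong x≈x′ y≈y′)) (M.trans xy≈z z≈z′) }
  }
  where module M = Magma M

ℚ⁺ : Set
ℚ⁺ = Σ ℚ ℚ.Positive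

_*⁺_ : ℚ⁺ → ℚ⁺ → ℚ⁺
(p , p>0) *⁺ (q , q>0) = p ℚ.* q , ℚ.pos*pos⇒pos p {{p>0}} q {{q>0}}

ℚ⁺-*-magma : Magma 0ℓ 0ℓ
ℚ⁺-*-magma = record
  { Carrier = ℚ⁺
  ; _≈_     = λ p q → proj₁ p ≡ proj₁ q
  ; _∙_     = _*⁺_
  ; isMagma = record
    { isEquivalence = On.isEquivalence proj₁ (Setoid.isEquivalence (setoid ℚ))
    ; ∙-cong        = cong₂ ℚ._*_
    }
  }

{-# OPTIONS --safe #-}
module Submission where

-- In a presentation of an Abelian group G, multiplication lengthens words by
-- at most a constant (pumping).  Pumping also shows that, when G/G² is
-- infinite, some word of length at most L + O(1) represents a coset of G²
-- that no word of length at most L represents.  Passing from B to B ∪ uB with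
-- such a u doubles, at the cost of O(1) in length, a set B of representatives
-- of different cosets, so 2ᵏ cosets have representatives of length O(k).  If
-- moreover square roots are unique, the products b₁(b₂(b₃⋯)²)² of m elements
-- of B are pairwise different, hence 2ᵏᵐ elements have words of length
-- O(k + m), which is more than there are such words once m is large and k
-- larger still.  In ℚ⁺ a prime dividing neither numerator nor denominator of
-- finitely many given numbers lies in none of their cosets.

open import Defs
open import Algebra.Bundles using (AbelianGroup; Magma)
open import Data.Bool.Base using (Bool; true; false)
open import Data.Empty using (⊥)
open import Data.Fin.Base as Fin using (Fin; zero; suc; combine; remQuot; funToFin; finToFun)
open import Data.Fin.Properties as Fin using (*↔×; +↔⊎; 2↔Bool; remQuot-combine)
open import Data.Fin.Subset using () renaming (_∈_ to _∈ˢ_)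
open import Data.Fin.Subset.Properties using (_∈?_)
import Data.Integer.Base as ℤ
import Data.Integer.Properties as ℤ
open import Data.List.Base as List
  using (List; []; _∷_; _++_; applyUpTo; drop; foldl; length; mapMaybe; tabulate; take)
open import Data.List.Properties as List
  using (drop-all; drop-drop; foldl-++; length-drop; length-take; take-all; take++drop≡id)
open import Data.List.Relation.Unary.All as All using (All; []; _∷_)
import Data.List.Relation.Unary.All.Properties as All
open import Data.Maybe.Base using (Maybe)
open import Data.Nat.Base
open import Data.Nat.Coprimality as Coprime using (1-coprimeTo)
open import Data.Nat.Divisibility
open import Data.Nat.Induction using (<-wellFounded; Acc; acc)
open import Data.Nat.ListAction using (product)
open import Data.Nat.ListAction.Properties using (∈⇒∣product; product≢0)
open import Data.Nat.Primality using (Prime; euclidsLemma; prime⇒nonTrivial; prime⇒nonZero; ¬prime[1])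
open import Data.Nat.Primality.Factorisation using (factorise)
open import Data.Nat.Properties
open import Data.Nat.Solver using (module +-*-Solver)
open import Data.Product.Base using (Σ; ∃₂; ∃-syntax; _×_; _,_; proj₁; proj₂)
open import Data.Product.Function.NonDependent.Propositional using (_×-↔_)
open import Data.Rational.Base as ℚ using (ℚ; ↥_; ↧ₙ_)
import Data.Rational.Properties as ℚ
import Data.Rational.Unnormalised.Base as ℚᵘ
import Data.Rational.Unnormalised.Properties as ℚᵘ
open import Data.Sum.Base using (_⊎_; inj₁; inj₂; reduce)
open import Data.Sum.Function.Propositional using (_⊎-↔_)
open import Data.Unit.Base using (⊤; tt)
open import Data.Vec.Base as Vec using (Vec; []; _∷_; lookup)
open import Data.Vec.Properties as Vec using (lookup-map)
open import Data.Vec.Relation.Unary.All as VecAll using ([]; _∷_)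
open import Effect.Monad using (RawMonad)
open import Function.Base using (_∘_; _$_)
open import Function.Bundles using (Bijection; Equivalence; Injection; Inverse; _⇔_; _↔_; mk⇔)
open import Function.Construct.Composition using (_↔-∘_)
open import Function.Construct.Identity using (↔-id)
open import Function.Properties.Inverse using (↔⇒↣)
open import Level using (0ℓ)
open import Relation.Binary.Definitions using (tri<; tri≈; tri>)
open import Relation.Binary.PropositionalEquality
  using (_≡_; _≢_; refl; sym; trans; cong; cong₂; subst; module ≡-Reasoning)
open import Relation.Nullary
open import Relation.Nullary.Decidable as Dec using (¬¬-excluded-middle)
open import Relation.Nullary.Negation using (¬¬-Monad)
open import Relation.Unary using (Pred)

private
  variable
    A : Set
    n : ℕ

-- Cutting and decoding convolutions.

applyUpTo-cong : ∀ {f g : ℕ → A} n → (∀ i → i < n → f i ≡ g i) → applyUpTo f n ≡ applyUpTo g n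
applyUpTo-cong zero    f≗g = refl
applyUpTo-cong (suc n) f≗g = cong₂ _∷_ (f≗g 0 z<s) (applyUpTo-cong n λ i i<n → f≗g (suc i) (s<s i<n))

applyUpTo-+ : ∀ (f : ℕ → A) m n → applyUpTo f (m + n) ≡ applyUpTo f m ++ applyUpTo (f ∘ (m +_)) n
applyUpTo-+ f zero    n = refl
applyUpTo-+ f (suc m) n = cong (f 0 ∷_) (applyUpTo-+ (f ∘ suc) m n)

symbolAt-drop : ∀ k i (w : List A) → symbolAt i (drop k w) ≡ symbolAt (k + i) w
symbolAt-drop k i w = cong List.head (drop-drop k i w)

symbolAt-take : ∀ k i (w : List A) → i < k → symbolAt i (take k w) ≡ symbolAt i w
symbolAt-take (suc k) i       []      i<k       = refl
symbolAt-take (suc k) zero    (x ∷ w) i<k       = refl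
symbolAt-take (suc k) (suc i) (x ∷ w) (s<s i<k) = symbolAt-take k i w i<k

maxLength-take : ∀ k (ws : Vec (List A) n) → maxLength (Vec.map (take k) ws) ≡ k ⊓ maxLength ws
maxLength-take k []       = sym (⊓-zeroʳ k)
maxLength-take k (w ∷ ws) =
  trans (cong₂ _⊔_ (length-take k w) (maxLength-take k ws)) (sym (⊓-distribˡ-⊔ k (length w) (maxLength ws)))

maxLength-drop : ∀ k (ws : Vec (List A) n) → maxLength (Vec.map (drop k) ws) ≡ maxLength ws ∸ k
maxLength-drop k []       = sym (0∸n≡0 k)
maxLength-drop k (w ∷ ws) =
  trans (cong₂ _⊔_ (length-drop k w) (maxLength-drop k ws)) (sym (∸-distribʳ-⊔ k (length w) (maxLength ws)))

-- A run of an automaton on a tuple can thus be interrupted at position `k` and resumed on the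
-- remainders; words that have ended by then continue as empty words, with the same padding.
⊗-split : ∀ k (ws : Vec (List A) n) → ⊗ ws ≡ ⊗ (Vec.map (take k) ws) ++ ⊗ (Vec.map (drop k) ws)
⊗-split k ws = begin
  applyUpTo (column ws) N
    ≡⟨ cong (applyUpTo (column ws)) (m⊓n+n∸m≡n k N) ⟨
  applyUpTo (column ws) (k ⊓ N + (N ∸ k))
    ≡⟨ applyUpTo-+ (column ws) (k ⊓ N) (N ∸ k) ⟩
  applyUpTo (column ws) (k ⊓ N) ++ applyUpTo (column ws ∘ (k ⊓ N +_)) (N ∸ k)
    ≡⟨ cong₂ _++_ (applyUpTo-cong (k ⊓ N) before) (applyUpTo-cong (N ∸ k) after) ⟩
  applyUpTo (column ws₁) (k ⊓ N) ++ applyUpTo (column ws₂) (N ∸ k)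
    ≡⟨ cong₂ (λ a b → applyUpTo (column ws₁) a ++ applyUpTo (column ws₂) b)
             (maxLength-take k ws) (maxLength-drop k ws) ⟨
  ⊗ ws₁ ++ ⊗ ws₂ ∎
  where
  open ≡-Reasoning
  N   = maxLength ws
  ws₁ = Vec.map (take k) ws
  ws₂ = Vec.map (drop k) ws
  column : Vec (List _) _ → ℕ → Vec (Maybe _) _
  column ws i = Vec.map (symbolAt i) ws
  before : ∀ i → i < k ⊓ N → column ws i ≡ column ws₁ i
  before i i<k⊓N =
    trans (Vec.map-cong (λ w → sym (symbolAt-take k i w (<-≤-trans i<k⊓N (m⊓n≤m k N)))) ws)
          (Vec.map-∘ (symbolAt i) (take k) ws)
  after : ∀ i → i < N ∸ k → column ws (k ⊓ N + i) ≡ column ws₂ i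
  after i i<N∸k =
    -- A column is left after the cut only if `k < N`, and then `k ⊓ N` is `k`.
    trans (cong (λ m → column ws (m + i)) (m≤n⇒m⊓n≡m {k} {N} (<⇒≤ (m∸n≢0⇒n<m (m<n⇒n≢0 i<N∸k)))))
    (trans (Vec.map-cong (λ w → sym (symbolAt-drop k i w)) ws)
           (Vec.map-∘ (symbolAt i) (drop k) ws))

-- `f` and `g` are general so that the induction may shift `f`; past the end of `w` every value is
-- `nothing` and gets deleted.
mapMaybe-symbolAt : ∀ {B : Set} (w : List A) N (f : ℕ → B) (g : B → Maybe A) →
                    (∀ i → g (f i) ≡ symbolAt i w) → length w ≤ N → mapMaybe g (applyUpTo f N) ≡ w
mapMaybe-symbolAt []      zero    f g eq _ = refl
mapMaybe-symbolAt []      (suc N) f g eq _ rewrite eq 0 =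
  mapMaybe-symbolAt [] N (f ∘ suc) g (λ { zero → eq 1 ; (suc i) → eq (2+ i) }) z≤n
mapMaybe-symbolAt (x ∷ w) (suc N) f g eq (s≤s ∣w∣≤N) rewrite eq 0 =
  cong (x ∷_) (mapMaybe-symbolAt w N (f ∘ suc) g (eq ∘ suc) ∣w∣≤N)

length-lookup≤maxLength : ∀ (ws : Vec (List A) n) i → length (lookup ws i) ≤ maxLength ws
length-lookup≤maxLength (w ∷ ws) zero    = m≤m⊔n _ _
length-lookup≤maxLength (w ∷ ws) (suc i) = ≤-trans (length-lookup≤maxLength ws i) (m≤n⊔m _ _)

-- Deleting the padding from the i-th track recovers the i-th word.
⊗-injective : ∀ {ws ws′ : Vec (List A) n} → ⊗ ws ≡ ⊗ ws′ → ws ≡ ws′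
⊗-injective {ws = ws} {ws′} eq = begin
  ws                        ≡⟨ Vec.tabulate∘lookup ws ⟨
  Vec.tabulate (lookup ws)  ≡⟨ Vec.tabulate-cong (λ i →
                                  trans (sym (decoded ws i)) (trans (cong (track i) eq) (decoded ws′ i))) ⟩
  Vec.tabulate (lookup ws′) ≡⟨ Vec.tabulate∘lookup ws′ ⟩
  ws′                       ∎
  where
  open ≡-Reasoning
  track : Fin _ → List (Vec (Maybe _) _) → List _
  track i = mapMaybe (λ c → lookup c i)
  decoded : ∀ ws i → track i (⊗ ws) ≡ lookup ws i
  decoded ws i = mapMaybe-symbolAt (lookup ws i) _ _ _
    (λ k → lookup-map i (symbolAt k) ws) (length-lookup≤maxLength ws i)

-- Prefix types and pumping down.

-- Prefixes of length at least L fall into finitely many types that determine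
-- which continuations lead into P.  The point is that m can be
-- independent of L for predicates P which themselves depend on L.
record FiniteIndex (L m : ℕ) (P : Pred (List A) 0ℓ) : Set₁ where
  field
    Class   : Set
    finite  : Fin m ↔ Class
    Before  : List A → Pred Class 0ℓ
    After   : Class → Pred (List A) 0ℓ
    split   : ∀ p s → L ≤ length p → P (p ++ s) → ∃[ χ ] (Before p χ × After χ s)
    join    : ∀ p s {χ} → L ≤ length p → Before p χ → After χ s → P (p ++ s)

  replace-prefix : ∀ {p p′} s → L ≤ length p → L ≤ length p′ → (∀ χ → Before p χ → Before p′ χ) →
                   P (p ++ s) → P (p′ ++ s)
  replace-prefix s L≤p L≤p′ p⇒p′ Pps with split _ s L≤p Pps
  ... | χ , b , a = join _ s L≤p′ (p⇒p′ χ b) a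

-- A type `T i` is a set of classes. Membership need not be decidable, but finitely many instances
-- of excluded middle hold jointly under double negation and turn each type into a vector of `m`
-- bits; among `2 ^ m + 1` such vectors two agree.
¬¬-pigeonhole : ∀ {X : Set} {m} → Fin m ↔ X → (T : ℕ → Pred X 0ℓ) →
                ¬ ¬ (∃₂ λ i j → i < j × j ≤ 2 ^ m × ∀ x → T i x ⇔ T j x)
¬¬-pigeonhole {X} {m} X-finite T ¬rep =
  Fin.sequence rawApplicative {P = λ (i : Fin (suc (2 ^ m))) → ∀ c → Dec (T (Fin.toℕ i) (to c))}
    (λ i → Fin.sequence rawApplicative (λ c → ¬¬-excluded-middle)) contradict
  where
  open RawMonad (¬¬-Monad {0ℓ}) using (rawApplicative)
  open Inverse X-finite using (to; from; strictlyInverseˡ)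
  transfer : ∀ {P Q : Set} (P? : Dec P) (Q? : Dec Q) → does P? ≡ does Q? → P → Q
  transfer P?        (yes q) eq p = q
  transfer (yes _)   (no ¬q) ()
  transfer (no ¬p)   (no ¬q) eq p = contradiction p ¬p
  contradict : ¬ (∀ (i : Fin (suc (2 ^ m))) c → Dec (T (Fin.toℕ i) (to c)))
  contradict T? = let i , j , i<j , eq = Fin.pigeonhole (n<1+n (2 ^ m)) (funToFin ∘ bits) in
    ¬rep (Fin.toℕ i , Fin.toℕ j , i<j , s≤s⁻¹ (Fin.toℕ<n j) , λ x →
      mk⇔ (same eq x) (same (sym eq) x))
    where
    bits : Fin (suc (2 ^ m)) → Fin m → Fin 2
    bits i c = Inverse.from 2↔Bool (does (T? i c))
    same : ∀ {i j} → funToFin (bits i) ≡ funToFin (bits j) → ∀ x → T (Fin.toℕ i) x → T (Fin.toℕ j) x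
    same {i} {j} eq x t = subst (T _) (strictlyInverseˡ x) $
      transfer (T? i (from x)) (T? j (from x))
        (trans (sym (Inverse.strictlyInverseˡ 2↔Bool _))
          (trans (cong (Inverse.to 2↔Bool) bit≡) (Inverse.strictlyInverseˡ 2↔Bool _)))
        (subst (T _) (sym (strictlyInverseˡ x)) t)
      where
      bit≡ : bits i (from x) ≡ bits j (from x)
      bit≡ = trans (sym (Fin.finToFun-funToFin (bits i) (from x)))
               (trans (cong (λ h → finToFun h (from x)) eq) (Fin.finToFun-funToFin (bits j) (from x)))

length-take-≤ : ∀ {k} {w : List A} → k ≤ length w → length (take k w) ≡ k
length-take-≤ {k = k} {w} k≤w = trans (length-take k w) (m≤n⇒m⊓n≡m k≤w)

-- Among the prefixes of lengths `L` to `L + 2 ^ (m + n)` two have the same type for `P` and `Q`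
-- together, and what lies between them can be deleted. `P` is carried to the shorter word and `Q`
-- back from it, as a descent inside `P` and outside `Q` requires.
shorten : ∀ {P Q : Pred (List A) 0ℓ} {L m n} → FiniteIndex L m P → FiniteIndex L n Q →
          ∀ w → L + 2 ^ (m + n) ≤ length w →
          ¬ ¬ (∃[ w′ ] (length w′ < length w × (P w → P w′) × (Q w′ → Q w)))
shorten {A} {P} {Q} {L} {m} {n} P-index Q-index w long ¬shorter =
  ¬¬-pigeonhole {X = P.Class ⊎ Q.Class} ((P.finite ⊎-↔ Q.finite) ↔-∘ +↔⊎)
    (λ i → λ { (inj₁ χ) → P.Before (prefix i) χ ; (inj₂ χ) → Q.Before (prefix i) χ }) excise
  where
  module P = FiniteIndex P-index
  module Q = FiniteIndex Q-index
  prefix : ℕ → List A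
  prefix i = take (L + i) w
  excise : ¬ _
  excise (i , j , i<j , j≤ , same) = ¬shorter
    ( prefix i ++ s , shorter
    , (λ Pw → P.replace-prefix s (L≤ j≤) (L≤ i≤) (λ χ → Equivalence.from (same (inj₁ χ)))
        (subst P (sym prefix-j++s≡w) Pw))
    , (λ Qw → subst Q prefix-j++s≡w
        (Q.replace-prefix s (L≤ i≤) (L≤ j≤) (λ χ → Equivalence.to (same (inj₂ χ))) Qw)))
    where
    i≤ = ≤-trans (<⇒≤ i<j) j≤
    s = drop (L + j) w
    prefix-j++s≡w : prefix j ++ s ≡ w
    prefix-j++s≡w = take++drop≡id (L + j) w
    ∣prefix∣ : ∀ {i} → i ≤ 2 ^ (m + n) → length (prefix i) ≡ L + i
    ∣prefix∣ i≤ = length-take-≤ {w = w} (≤-trans (+-monoʳ-≤ L i≤) long)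
    L≤ : ∀ {i} → i ≤ 2 ^ (m + n) → L ≤ length (prefix i)
    L≤ i≤ = ≤-trans (m≤m+n L _) (≤-reflexive (sym (∣prefix∣ i≤)))
    shorter : length (prefix i ++ s) < length w
    shorter = begin-strict
      length (prefix i ++ s)       ≡⟨ List.length-++ (prefix i) ⟩
      length (prefix i) + length s ≡⟨ cong (_+ length s) (∣prefix∣ i≤) ⟩
      L + i + length s             <⟨ +-monoˡ-< (length s) (+-monoʳ-< L i<j) ⟩
      L + j + length s             ≡⟨ cong (_+ length s) (∣prefix∣ j≤) ⟨
      length (prefix j) + length s ≡⟨ List.length-++ (prefix j) ⟨
      length (prefix j ++ s)       ≡⟨ cong length prefix-j++s≡w ⟩
      length w                     ∎
      where open ≤-Reasoning

-- Finite index from automata.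

-- When reading is cut at position k, a word is either still running there
-- (`true`) or has ended by then, so that its remainder is empty (`false`).
Prefix : ℕ → Bool → Pred (List A) 0ℓ
Prefix k true  p = length p ≡ k
Prefix k false p = length p ≤ k

Suffix : Bool → Pred (List A) 0ℓ
Suffix true  s = ⊤
Suffix false s = s ≡ []

cut : ∀ k (w : List A) → ∃[ b ] (Prefix k b (take k w) × Suffix b (drop k w))
cut k w with ≤-total k (length w)
... | inj₁ k≤w = true  , length-take-≤ {w = w} k≤w , tt
... | inj₂ w≤k = false , ≤-trans (≤-reflexive (cong length (take-all k w w≤k))) w≤k , drop-all k w w≤k

take-drop-length : ∀ (p s : List A) → take (length p) (p ++ s) ≡ p × drop (length p) (p ++ s) ≡ s
take-drop-length []      s = refl , refl
take-drop-length (x ∷ p) s = let t , d = take-drop-length p s in cong (x ∷_) t , d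

uncut : ∀ k b (p s : List A) → Prefix k b p → Suffix b s → take k (p ++ s) ≡ p × drop k (p ++ s) ≡ s
uncut k true  p s refl tt = take-drop-length p s
uncut k false p .[] p≤k refl =
  trans (cong (take k) (List.++-identityʳ p)) (take-all k p p≤k) ,
  trans (cong (drop k) (List.++-identityʳ p)) (drop-all k p p≤k)

regular-finiteIndex : ∀ {P : Pred (List A) 0ℓ} L (P-reg : Regular P) →
                      FiniteIndex L (DFA.states (proj₁ P-reg)) P
regular-finiteIndex L (M , P⇔) = record
  { finite = ↔-id _
  ; Before = λ p q → foldl step start p ≡ q
  ; After  = λ q s → foldl step q s ∈ˢ final
  ; split  = λ p s _ Pps → _ , refl , subst (_∈ˢ final) (foldl-++ step start p s) (Equivalence.to (P⇔ _) Pps)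
  ; join   = λ { p s _ refl accepted →
                 Equivalence.from (P⇔ _) (subst (_∈ˢ final) (sym (foldl-++ step start p s)) accepted) }
  }
  where open DFA M

module Ternary {R : Pred (Vec (List A) 3) 0ℓ} (R-rec : FARecognisable R) where
  open DFA (proj₁ R-rec) public using (states; step; start; final)

  run : Fin states → List A → List A → List A → Fin states
  run q x y z = foldl step q (⊗ (x ∷ y ∷ z ∷ []))

  accept⇔ : ∀ k {x₁ y₁ z₁ x₂ y₂ z₂ x y z} →
            take k x ≡ x₁ × drop k x ≡ x₂ → take k y ≡ y₁ × drop k y ≡ y₂ → take k z ≡ z₁ × drop k z ≡ z₂ →
            R (x ∷ y ∷ z ∷ []) ⇔ run (run start x₁ y₁ z₁) x₂ y₂ z₂ ∈ˢ final
  accept⇔ k {x = x} {y} {z} (refl , refl) (refl , refl) (refl , refl) = mk⇔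
    (λ r → subst (_∈ˢ final) run≡ (Equivalence.to (proj₂ R-rec _) (xyz , r , refl)))
    (λ accepted →
      -- Acceptance yields only some related tuple with this convolution; injectivity identifies it
      -- with `xyz`.
      let _ , r , eq = Equivalence.from (proj₂ R-rec (⊗ xyz)) (subst (_∈ˢ final) (sym run≡) accepted)
      in subst R (sym (⊗-injective eq)) r)
    where
    xyz = x ∷ y ∷ z ∷ []
    run≡ : foldl step start (⊗ xyz) ≡
           run (run start (take k x) (take k y) (take k z)) (drop k x) (drop k y) (drop k z)
    run≡ = trans (cong (foldl step start) (⊗-split k xyz))
                 (foldl-++ step start (⊗ (Vec.map (take k) xyz)) (⊗ (Vec.map (drop k) xyz)))

  ended : ∀ {k} (w : List A) → length w ≤ k → take k w ≡ w × drop k w ≡ []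
  ended w w≤k = take-all _ w w≤k , drop-all _ w w≤k

  -- Once `x` and `y` have ended only the third track carries symbols, so the state reached is all
  -- that matters, and the number of classes depends on neither word.
  fibre-finiteIndex : ∀ x y → FiniteIndex (length x ⊔ length y) states (λ z → R (x ∷ y ∷ z ∷ []))
  fibre-finiteIndex x y = record
    { finite = ↔-id _
    ; Before = λ p q → run start x y p ≡ q
    ; After  = λ q s → run q [] [] s ∈ˢ final
    ; split  = λ p s L≤p r → _ , refl , Equivalence.to (cut-at p s L≤p) r
    ; join   = λ { p s L≤p refl accepted → Equivalence.from (cut-at p s L≤p) accepted }
    }
    where
    cut-at : ∀ p s → length x ⊔ length y ≤ length p →
             R (x ∷ y ∷ (p ++ s) ∷ []) ⇔ run (run start x y p) [] [] s ∈ˢ final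
    cut-at p s L≤p = accept⇔ (length p)
      (ended x (≤-trans (m≤m⊔n _ _) L≤p)) (ended y (≤-trans (m≤n⊔m _ _) L≤p)) (take-drop-length p s)

  -- When R is the graph of a product, this says that u lies in y⁻¹G² for
  -- some y of length at most L.
  NearSquare : ℕ → Pred (List A) 0ℓ
  NearSquare L u = ∃[ y ] ∃[ z ] ∃[ w ] (length y ≤ L × R (z ∷ z ∷ w ∷ []) × R (y ∷ u ∷ w ∷ []))

  -- The witness `y` has ended at the cut, while `z` and `w` are guessed in two pieces. A class
  -- records the states of both runs and whether `z` and `w` may go on past the cut, so that pieces
  -- from different witnesses fit together. The number of classes does not depend on `L`.
  nearSquare-finiteIndex : ∀ L → FiniteIndex L (states * (states * (2 * 2))) (NearSquare L)
  nearSquare-finiteIndex L = record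
    { Class  = Fin states × Fin states × Bool × Bool
    ; finite = (↔-id _ ×-↔ ((↔-id _ ×-↔ ((2↔Bool ×-↔ 2↔Bool) ↔-∘ *↔×)) ↔-∘ *↔×)) ↔-∘ *↔×
    ; Before = λ { p (q₁ , q₂ , a , b) → ∃[ y ] ∃[ z ] ∃[ w ]
                   ( length y ≤ L × Prefix (length p) a z × Prefix (length p) b w
                   × run start z z w ≡ q₁ × run start y p w ≡ q₂) }
    ; After  = λ { (q₁ , q₂ , a , b) s → ∃[ z ] ∃[ w ]
                   (Suffix a z × Suffix b w × run q₁ z z w ∈ˢ final × run q₂ [] s w ∈ˢ final) }
    ; split  = λ { p s L≤p (y , z , w , y≤L , zz≡w , yu≡w) →
                   let k = length p
                       a , z₁ , z₂ = cut k z
                       b , w₁ , w₂ = cut k w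
                   in _ , (y , take k z , take k w , y≤L , z₁ , w₁ , refl , refl)
                        , (drop k z , drop k w , z₂ , w₂
                          , Equivalence.to (accept⇔ k (refl , refl) (refl , refl) (refl , refl)) zz≡w
                          , Equivalence.to
                              (accept⇔ k (ended y (≤-trans y≤L L≤p)) (take-drop-length p s) (refl , refl)) yu≡w) }
    ; join   = λ { p s {_ , _ , a , b} L≤p (y , z₁ , w₁ , y≤L , z₁-pre , w₁-pre , refl , refl)
                   (z₂ , w₂ , z₂-suf , w₂-suf , zz≡w , yu≡w) →
                   let k = length p
                       z-cut = uncut k a z₁ z₂ z₁-pre z₂-suf
                       w-cut = uncut k b w₁ w₂ w₁-pre w₂-suf
                   in y , z₁ ++ z₂ , w₁ ++ w₂ , y≤L
                      , Equivalence.from (accept⇔ k z-cut z-cut w-cut) zz≡w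
                      , Equivalence.from
                          (accept⇔ k (ended y (≤-trans y≤L L≤p)) (take-drop-length p s) w-cut) yu≡w }
    }

-- Counting words, and the choice of parameters.

module _ {s : ℕ} where

  -- Words become strings of `L` digits in base `suc s`, the digit `zero` marking the end; longer
  -- words are truncated.
  code : ∀ L → List (Fin s) → Fin (suc s ^ L)
  code zero    w       = zero
  code (suc L) []      = combine {suc s} zero (code L [])
  code (suc L) (x ∷ w) = combine (suc x) (code L w)

  decode : ∀ L → Fin (suc s ^ L) → List (Fin s)
  prepend : ∀ L → Fin (suc s) × Fin (suc s ^ L) → List (Fin s)
  decode zero    i = []
  decode (suc L) i = prepend L (remQuot {suc s} (suc s ^ L) i)
  prepend L (zero  , i) = []
  prepend L (suc x , i) = x ∷ decode L i

  decode-code : ∀ L w → length w ≤ L → decode L (code L w) ≡ w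
  decode-code zero    []      _         = refl
  decode-code (suc L) []      _         = cong (prepend L) (remQuot-combine {suc s} zero (code L []))
  decode-code (suc L) (x ∷ w) (s≤s w≤L) =
    trans (cong (prepend L) (remQuot-combine (suc x) (code L w))) (cong (x ∷_) (decode-code L w w≤L))

n<2^n : ∀ n → n < 2 ^ n
n<2^n zero    = z<s
n<2^n (suc n) = begin-strict
  suc n         <⟨ +-mono-≤-< (m^n>0 2 n) (n<2^n n) ⟩
  2 ^ n + 2 ^ n ≡⟨ cong (2 ^ n +_) (+-identityʳ (2 ^ n)) ⟨
  2 ^ suc n     ∎
  where open ≤-Reasoning

exponential-beats-linear : ∀ s a c e → ∃₂ λ k m → s ^ (a + k * c + m * e) < (2 ^ k) ^ m
exponential-beats-linear s a c e = k , m , (begin-strict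
  s ^ ℓ       ≤⟨ ^-monoˡ-≤ ℓ (<⇒≤ (n<2^n s)) ⟩
  (2 ^ s) ^ ℓ ≡⟨ ^-*-assoc 2 s ℓ ⟩
  2 ^ (s * ℓ) <⟨ ^-monoʳ-< 2 (s<s z<s) sℓ<km ⟩
  2 ^ (k * m) ≡⟨ ^-*-assoc 2 k m ⟨
  (2 ^ k) ^ m ∎)
  where
  open ≤-Reasoning
  -- In `s * ℓ` the coefficient of `k` is `s * c`, so `m` has to exceed it; `k` is then chosen to
  -- make `k * m` equal to `1 + s * ℓ`.
  m = suc (s * c)
  k = suc (s * a + s * m * e)
  ℓ = a + k * c + m * e
  sℓ<km : s * ℓ < k * m
  sℓ<km = ≤-reflexive (solve 5
    (λ s a c m e → let k = con 1 :+ (s :* a :+ s :* m :* e) in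
      con 1 :+ s :* (a :+ k :* c :+ m :* e) := k :* (con 1 :+ s :* c)) refl s a c m e)
    where open +-*-Solver

-- Cosets of the subgroup of squares.

module Squares {c ℓ} (G : AbelianGroup c ℓ) where
  open AbelianGroup G renaming (refl to ≈-refl; sym to ≈-sym; trans to ≈-trans)
  open import Algebra.Properties.AbelianGroup G using (⁻¹-∙-comm)
  open import Algebra.Properties.CommutativeSemigroup commutativeSemigroup using (interchange)
  open import Relation.Binary.Reasoning.Setoid setoid

  IsSquare : Pred Carrier _
  IsSquare x = ∃[ z ] z ∙ z ≈ x

  IsSquare-resp : ∀ {x y} → x ≈ y → IsSquare x → IsSquare y
  IsSquare-resp x≈y (z , zz≈x) = z , ≈-trans zz≈x x≈y

  IsSquare-cancelˡ : ∀ x y → IsSquare ((x ∙ x) ∙ y) → IsSquare y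
  IsSquare-cancelˡ x y (z , zz≈xxy) = x ⁻¹ ∙ z , (begin
    (x ⁻¹ ∙ z) ∙ (x ⁻¹ ∙ z)       ≈⟨ interchange _ _ _ _ ⟩
    (x ⁻¹ ∙ x ⁻¹) ∙ (z ∙ z)       ≈⟨ ∙-cong (⁻¹-∙-comm x x) zz≈xxy ⟩
    (x ∙ x) ⁻¹ ∙ ((x ∙ x) ∙ y)    ≈⟨ assoc _ _ _ ⟨
    (x ∙ x) ⁻¹ ∙ (x ∙ x) ∙ y      ≈⟨ ∙-congʳ (inverseˡ (x ∙ x)) ⟩
    ε ∙ y                         ≈⟨ identityˡ y ⟩
    y                             ∎)

module _ {c ℓ} (G : AbelianGroup c ℓ) where
  open AbelianGroup G hiding (refl; sym; trans)
  open Squares G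

  UniqueRoots : Set _
  UniqueRoots = ∀ x y → x ∙ x ≈ y ∙ y → x ≈ y

  -- Finitely many cosets of the subgroup of squares never exhaust the group
  -- (b and b⁻¹ lie in the same coset).
  InfiniteSquareIndex : Set _
  InfiniteSquareIndex = ∀ {n} (b : Fin n → Carrier) → ∃[ x ] (∀ i → ¬ IsSquare (b i ∙ x))

-- Lengths of elements in a presentation.

module Presentation {c ℓ} (G : AbelianGroup c ℓ) (F : FAPresentable (graphStructure (AbelianGroup.magma G))) where
  open AbelianGroup G renaming (refl to ≈-refl; sym to ≈-sym; trans to ≈-trans)
  open Squares G
  open FAPresentable F hiding (R)
  open _≅_ iso

  R : Pred (Vec Word 3) 0ℓ
  R = FAPresentable.R F tt

  open Ternary {R = R} (R-FARecognisable tt)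
    using (states; NearSquare; fibre-finiteIndex; nearSquare-finiteIndex)

  ⟦_⟧ : Carrier → Word
  ⟦ x ⟧ = proj₁ (to x)

  ∣_∣ : Carrier → ℕ
  ∣ x ∣ = length ⟦ x ⟧

  graph⇔ : ∀ x y z → x ∙ y ≈ z ⇔ R (⟦ x ⟧ ∷ ⟦ y ⟧ ∷ ⟦ z ⟧ ∷ [])
  graph⇔ x y z = rel-iff tt (x ∷ y ∷ z ∷ [])

  element : ∀ w → D w → ∃[ x ] ⟦ x ⟧ ≡ w
  element w d = let x , eq = Bijection.surjective bijection (w , d) in x , eq ≈-refl

  -- The bounds supplied by `shorten`: for `wordGap` the fibre of the graph serves as both
  -- predicates, for `elementGap` they are `D` and `NearSquare L`.
  wordGap elementGap : ℕ
  wordGap    = 2 ^ (states + states)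
  elementGap = 2 ^ (DFA.states (proj₁ D-regular) + states * (states * (2 * 2)))

  -- Pumping down a longer word would put a second, shorter word in the fibre over `⟦ x ⟧` and
  -- `⟦ y ⟧`, but the product has only one word.
  ∣∙∣< : ∀ x y → ∣ x ∙ y ∣ < ∣ x ∣ ⊔ ∣ y ∣ + wordGap
  ∣∙∣< x y = ≰⇒> λ long → shorten index index ⟦ x ∙ y ⟧ long λ { (w , shorter , r , _) →
    let xyw = r (Equivalence.to (graph⇔ x y (x ∙ y)) ≈-refl)
        z , z≡w = element w (VecAll.head (VecAll.tail (VecAll.tail (R⊆D tt xyw))))
        xy≈z = Equivalence.from (graph⇔ x y z) (subst (λ w → R (⟦ x ⟧ ∷ ⟦ y ⟧ ∷ w ∷ [])) (sym z≡w) xyw)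
    in <-irrefl (cong length (trans (sym z≡w) (sym (Bijection.cong bijection xy≈z)))) shorter }
    where index = fibre-finiteIndex ⟦ x ⟧ ⟦ y ⟧

  ∣∙∣≤ : ∀ x y {a} → ∣ x ∣ ≤ a → ∣ y ∣ ≤ a → ∣ x ∙ y ∣ ≤ a + wordGap
  ∣∙∣≤ x y x≤a y≤a = ≤-trans (<⇒≤ (∣∙∣< x y)) (+-monoˡ-≤ wordGap (⊔-lub x≤a y≤a))

  nearSquare⇔ : ∀ L x → NearSquare L ⟦ x ⟧ ⇔ (∃[ y ] (∣ y ∣ ≤ L × IsSquare (y ∙ x)))
  nearSquare⇔ L x = mk⇔ fwd bwd
    where
    fwd : NearSquare L ⟦ x ⟧ → ∃[ y ] (∣ y ∣ ≤ L × IsSquare (y ∙ x))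
    fwd (y , z , w , y≤L , zzw , yxw)
      with R⊆D tt zzw | R⊆D tt yxw
    ... | dz ∷ _ ∷ dw ∷ [] | dy ∷ _
      with element y dy | element z dz | element w dw
    ... | y′ , refl | z′ , refl | w′ , refl =
      y′ , y≤L , z′ ,
      ≈-trans (Equivalence.from (graph⇔ z′ z′ w′) zzw) (≈-sym (Equivalence.from (graph⇔ y′ x w′) yxw))
    bwd : ∃[ y ] (∣ y ∣ ≤ L × IsSquare (y ∙ x)) → NearSquare L ⟦ x ⟧
    bwd (y , y≤L , z , zz≈yx) =
      ⟦ y ⟧ , ⟦ z ⟧ , ⟦ y ∙ x ⟧ , y≤L ,
      Equivalence.to (graph⇔ z z (y ∙ x)) zz≈yx , Equivalence.to (graph⇔ y x (y ∙ x)) ≈-refl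

  D? : ∀ w → Dec (D w)
  D? w = Dec.map (mk⇔ (Equivalence.from (proj₂ D-regular w)) (Equivalence.to (proj₂ D-regular w))) (_ ∈? _)

  -- Junk value ε for words outside the domain.
  wordElement : Word → Carrier
  wordElement w with D? w
  ... | yes d = proj₁ (element w d)
  ... | no  _ = ε

  wordElement-⟦⟧ : ∀ x → wordElement ⟦ x ⟧ ≈ x
  wordElement-⟦⟧ x with D? ⟦ x ⟧
  ... | yes d = Bijection.injective bijection (proj₂ (element ⟦ x ⟧ d))
  ... | no ¬d = contradiction (proj₂ (to x)) ¬d

  -- From a word outside all cosets met at length at most `L`, `shorten` descends within `D` and
  -- outside those cosets until the length is below `L + elementGap`. `NearSquare L` is not decided,
  -- so the descent refutes its negation instead of proving it.
  short-representative : InfiniteSquareIndex G → ∀ L →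
    ¬ ¬ (∃[ x ] (∣ x ∣ ≤ L + elementGap × (∀ y → ∣ y ∣ ≤ L → ¬ IsSquare (y ∙ x))))
  short-representative infinite L none =
    -- `decode L` enumerates all words of length at most `L`, hence a finite family meeting all the
    -- cosets to be avoided.
    let x , ¬square = infinite (wordElement ∘ decode L) in
    descend ⟦ x ⟧ (<-wellFounded _) (proj₂ (to x)) λ near →
      let y , y≤L , sq = Equivalence.to (nearSquare⇔ L x) near in
      ¬square (code L ⟦ y ⟧) (IsSquare-resp (∙-congʳ (≈-sym (decoded y y≤L))) sq)
    where
    decoded : ∀ y → ∣ y ∣ ≤ L → wordElement (decode L (code L ⟦ y ⟧)) ≈ y
    decoded y y≤L = ≈-trans (reflexive (cong wordElement (decode-code L ⟦ y ⟧ y≤L))) (wordElement-⟦⟧ y)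
    descend : ∀ w → Acc _<_ (length w) → D w → ¬ ¬ NearSquare L w
    descend w (acc rec) d ¬near with <-≤-connex (length w) (L + elementGap)
    ... | inj₁ short with element w d
    ...   | x , refl = none (x , <⇒≤ short , λ y y≤L sq →
      ¬near (Equivalence.from (nearSquare⇔ L x) (y , y≤L , sq)))
    descend w (acc rec) d ¬near | inj₂ long =
      shorten (regular-finiteIndex L D-regular) (nearSquare-finiteIndex L) w long
        λ { (w′ , shorter , d′ , near′) → descend w′ (rec shorter) (d′ d) (¬near ∘ near′) }

  -- The product can replace the quotient because `b j` and its inverse lie in the same coset of the
  -- squares; the entries thus represent different cosets.
  Separated : ∀ {n} → (Fin n → Carrier) → Set _
  Separated b = ∀ i j → i ≢ j → ¬ IsSquare (b i ∙ b j)

  module _ {n} (b : Fin n → Carrier) (u : Carrier) where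

    double′ : Fin 2 × Fin n → Carrier
    double′ (zero  , i) = b i
    double′ (suc _ , i) = u ∙ b i

    double : Fin (2 * n) → Carrier
    double = double′ ∘ remQuot {2} n

    -- Across the two halves `far` applies; inside the second half the factor `u ∙ u` does not
    -- change the coset.
    double-separated : Separated b → (∀ i j → ¬ IsSquare ((b i ∙ b j) ∙ u)) → Separated double
    double-separated sep far i j i≢j = separated′ (remQuot {2} n i) (remQuot {2} n j) (i≢j ∘ remQuot-injective)
      where
      open import Algebra.Properties.CommutativeSemigroup commutativeSemigroup
        using (interchange; x∙yz≈xz∙y; xy∙z≈yz∙x)
      remQuot-injective : ∀ {i j} → remQuot {2} n i ≡ remQuot {2} n j → i ≡ j
      remQuot-injective = Injection.injective (↔⇒↣ (*↔× {2} {n}))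
      separated′ : ∀ i j → i ≢ j → ¬ IsSquare (double′ i ∙ double′ j)
      separated′ (zero     , i) (zero     , j) i≢j = sep i j (i≢j ∘ cong (zero ,_))
      separated′ (zero     , i) (suc _    , j) i≢j = far i j ∘ IsSquare-resp (x∙yz≈xz∙y _ _ _)
      separated′ (suc _    , i) (zero     , j) i≢j = far i j ∘ IsSquare-resp (xy∙z≈yz∙x _ _ _)
      separated′ (suc zero , i) (suc zero , j) i≢j =
        sep i j (i≢j ∘ cong (suc zero ,_)) ∘ IsSquare-cancelˡ u _ ∘ IsSquare-resp (interchange _ _ _ _)

  -- The price of one doubling: the products `b i ∙ b j` to be avoided, the search for `u`, and the
  -- products `u ∙ b i`.
  familyGap : ℕ
  familyGap = wordGap + elementGap + wordGap

  ShortSeparated : ℕ → Set _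
  ShortSeparated k = Σ (Fin (2 ^ k) → Carrier) λ b → (∀ i → ∣ b i ∣ ≤ ∣ ε ∣ + k * familyGap) × Separated b

  shortSeparated : InfiniteSquareIndex G → ∀ k → ¬ ¬ ShortSeparated k
  shortSeparated infinite zero    none = none
    ((λ _ → ε) , (λ _ → m≤m+n _ 0) , λ { zero zero 0≢0 → contradiction refl 0≢0 })
  shortSeparated infinite (suc k) none =
    shortSeparated infinite k λ { (b , b≤ , sep) →
    -- With the bound `a + wordGap`, `far` covers all products `b i ∙ b j`.
    short-representative infinite (a + wordGap) λ { (u , u≤ , far) →
    none (double b u , double′≤ b u b≤ u≤ ∘ remQuot {2} (2 ^ k) ,
      double-separated b u sep λ i j → far (b i ∙ b j) (∣∙∣≤ (b i) (b j) (b≤ i) (b≤ j))) } }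
    where
    a = ∣ ε ∣ + k * familyGap
    room : ∀ {x} → x ≤ a + wordGap + elementGap + wordGap → x ≤ ∣ ε ∣ + suc k * familyGap
    room x≤ = ≤-trans x≤ (≤-reflexive (solve 4 (λ e k w g → let f = w :+ g :+ w in
      e :+ k :* f :+ w :+ g :+ w := e :+ (f :+ k :* f)) refl ∣ ε ∣ k wordGap elementGap))
      where open +-*-Solver
    a≤ : a ≤ a + wordGap + elementGap
    a≤ = ≤-trans (m≤m+n a wordGap) (m≤m+n _ elementGap)
    double′≤ : ∀ b u → (∀ i → ∣ b i ∣ ≤ a) → ∣ u ∣ ≤ a + wordGap + elementGap →
               ∀ p → ∣ double′ b u p ∣ ≤ ∣ ε ∣ + suc k * familyGap
    double′≤ b u b≤ u≤ (zero  , j) = room (≤-trans (b≤ j) (≤-trans a≤ (m≤m+n _ wordGap)))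
    double′≤ b u b≤ u≤ (suc _ , j) = room (∣∙∣≤ u (b j) u≤ (≤-trans (b≤ j) a≤))

  -- Products as numerals with digits in `b`.

  module _ {n} (b : Fin n → Carrier) where

    horner : ∀ m → Fin (n ^ m) → Carrier
    hornerStep : ∀ m → Fin n × Fin (n ^ m) → Carrier
    horner zero    _ = ε
    horner (suc m) i = hornerStep m (remQuot {n} (n ^ m) i)
    hornerStep m (i , r) = (horner m r ∙ horner m r) ∙ b i

    -- A product costs the maximum of two lengths plus `wordGap`, so the bound `a` on the digits
    -- enters once and is not multiplied by `m`; each digit adds only a squaring and a
    -- multiplication.
    horner≤ : ∀ {a} → ∣ ε ∣ ≤ a → (∀ i → ∣ b i ∣ ≤ a) → ∀ m i → ∣ horner m i ∣ ≤ a + m * (wordGap + wordGap)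
    horner≤ ε≤a b≤a zero    i = ≤-trans ε≤a (m≤m+n _ 0)
    horner≤ {a} ε≤a b≤a (suc m) i = ≤-trans
      (∣∙∣≤ (x ∙ x) (b j) (∣∙∣≤ x x x≤ x≤)
        (≤-trans (b≤a j) (≤-trans (m≤m+n a _) (m≤m+n _ wordGap))))
      (≤-reflexive (solve 3 (λ a v w → a :+ v :+ w :+ w := a :+ (w :+ w :+ v)) refl
        a (m * (wordGap + wordGap)) wordGap))
      where
      open +-*-Solver
      j = proj₁ (remQuot {n} (n ^ m) i)
      x = horner m (proj₂ (remQuot {n} (n ^ m) i))
      x≤ = horner≤ ε≤a b≤a m (proj₂ (remQuot {n} (n ^ m) i))

    -- x²b ≈ x′²b′ puts b and b′ in the same coset of the squares, so b = b′
    -- and then x ≈ x′: the digits in G/G² can be read off one by one.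
    horner-injective : UniqueRoots G → Separated b → ∀ m {i j} → horner m i ≈ horner m j → i ≡ j
    horner-injective unique sep zero    {zero} {zero} _ = refl
    horner-injective unique sep (suc m) eq =
      Injection.injective (↔⇒↣ (*↔× {n} {n ^ m})) (step _ _ eq)
      where
      open import Algebra.Properties.Group group using (∙-cancelʳ)
      open import Algebra.Properties.CommutativeSemigroup commutativeSemigroup using (interchange)
      step : ∀ p q → hornerStep m p ≈ hornerStep m q → p ≡ q
      step (i , r) (j , s) eq with i Fin.≟ j
      ... | yes refl = cong (i ,_) (horner-injective unique sep m (unique _ _ (∙-cancelʳ (b i) _ _ eq)))
      ... | no i≢j   = contradiction (IsSquare-cancelˡ x (b i ∙ b j) (y ∙ b j , ≈-sym (begin
        (x ∙ x) ∙ (b i ∙ b j)       ≈⟨ assoc _ _ _ ⟨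
        ((x ∙ x) ∙ b i) ∙ b j       ≈⟨ ∙-congʳ eq ⟩
        ((y ∙ y) ∙ b j) ∙ b j       ≈⟨ assoc _ _ _ ⟩
        (y ∙ y) ∙ (b j ∙ b j)       ≈⟨ interchange _ _ _ _ ⟩
        (y ∙ b j) ∙ (y ∙ b j)       ∎))) (sep i j i≢j)
        where
        open import Relation.Binary.Reasoning.Setoid setoid
        x = horner m r
        y = horner m s

  absurd : UniqueRoots G → InfiniteSquareIndex G → ⊥
  absurd unique infinite =
    -- The base is `suc alphabetSize` because `code` spends one more digit on the end of a word.
    let k , m , few = exponential-beats-linear (suc alphabetSize) ∣ ε ∣ familyGap (wordGap + wordGap) in
    shortSeparated infinite k λ { (b , b≤ , sep) →
    let L = ∣ ε ∣ + k * familyGap + m * (wordGap + wordGap)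
        fits = horner≤ b (m≤m+n _ _) b≤ m
        i , j , i<j , same = Fin.pigeonhole few (code L ∘ ⟦_⟧ ∘ horner b m)
        words≡ = trans (sym (decode-code L _ (fits i))) (trans (cong (decode L) same) (decode-code L _ (fits j)))
    in Fin.<⇒≢ i<j (horner-injective b unique sep m (Bijection.injective bijection words≡)) }

¬FAPresentable : ∀ {c ℓ} (G : AbelianGroup c ℓ) → UniqueRoots G → InfiniteSquareIndex G →
                 ¬ FAPresentable (graphStructure (AbelianGroup.magma G))
¬FAPresentable G unique infinite F = Presentation.absurd G F unique infinite

-- Primes and infinite descent.

prime-divisor : ∀ n → n ≢ 1 → .{{NonZero n}} → ∃[ p ] (Prime p × p ∣ n)
prime-divisor n n≢1 with factorise n
... | record { factors = [] ; isFactorisation = eq } = contradiction eq n≢1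
... | record { factors = p ∷ ps ; isFactorisation = refl ; factorsPrime = p-prime ∷ _ } =
  p , p-prime , m∣m*n (product ps)

-- Euclid: a prime factor of 1 + ∏ ns.
prime-avoiding : ∀ ns → All NonZero ns → ∃[ p ] (Prime p × All (p ∤_) ns)
prime-avoiding ns ns≢0 =
  let p , p-prime , p∣ = prime-divisor (suc (product ns))
        (≢-nonZero⁻¹ (product ns) {{product≢0 ns≢0}} ∘ suc-injective)
  in p , p-prime , All.tabulate λ n∈ns p∣n → ¬prime[1] (subst Prime
       (∣1⇒≡1 (∣m+n∣m⇒∣n (subst (p ∣_) (+-comm 1 (product ns)) p∣) (∣-trans p∣n (∈⇒∣product n∈ns)))) p-prime)

prime∣square : ∀ {p} m → Prime p → p ∣ m * m → p ∣ m
prime∣square m p-prime p∣mm = reduce (euclidsLemma m m p-prime p∣mm)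

-- Infinite descent: the prime p divides s, hence t, and both quotients
-- satisfy the same equation.
p·d·t²≢n·s² : ∀ {p d n} → Prime p → p ∤ d → p ∤ n → ∀ s t → .{{NonZero t}} → p * d * (t * t) ≢ n * (s * s)
p·d·t²≢n·s² {p} {d} {n} p-prime p∤d p∤n s t eq = descent s t (<-wellFounded t) eq
  where
  instance
    p≢0 = prime⇒nonZero p-prime
  descent : ∀ s t → .{{NonZero t}} → Acc _<_ t → p * d * (t * t) ≢ n * (s * s)
  descent s t (acc rec) eq with euclidsLemma n (s * s) p-prime (subst (p ∣_) eq (∣-trans (m∣m*n d) (m∣m*n (t * t))))
  ... | inj₁ p∣n = p∤n p∣n
  ... | inj₂ p∣ss with prime∣square s p-prime p∣ss
  ...   | divides s′ refl with euclidsLemma d (t * t) p-prime (divides (n * (s′ * s′)) d·t²≡)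
    where
    d·t²≡ : d * (t * t) ≡ n * (s′ * s′) * p
    d·t²≡ = *-cancelˡ-≡ _ _ p (trans (sym (*-assoc p d (t * t))) (trans eq
      (solve 3 (λ n s p → n :* (s :* p :* (s :* p)) := p :* (n :* (s :* s) :* p)) refl n s′ p)))
      where open +-*-Solver
  ...     | inj₁ p∣d = p∤d p∣d
  ...     | inj₂ p∣tt with prime∣square t p-prime p∣tt
  ...       | divides t′ refl = descent s′ t′ {{t′≢0}} (rec t′<t) (*-cancelˡ-≡ _ _ (p * p) {{m*n≢0 p p}} (begin
    p * p * (p * d * (t′ * t′))
      ≡⟨ solve 3 (λ p d t → p :* p :* (p :* d :* (t :* t)) := p :* d :* (t :* p :* (t :* p))) refl p d t′ ⟩
    p * d * (t′ * p * (t′ * p))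
      ≡⟨ eq ⟩
    n * (s′ * p * (s′ * p))
      ≡⟨ solve 3 (λ p n s → n :* (s :* p :* (s :* p)) := p :* p :* (n :* (s :* s))) refl p n s′ ⟩
    p * p * (n * (s′ * s′)) ∎))
    where
    open +-*-Solver
    open ≡-Reasoning
    t′≢0 : NonZero t′
    t′≢0 = m*n≢0⇒m≢0 t′
    t′<t : t′ < t′ * p
    t′<t = m<m*n t′ p {{t′≢0}} (nonTrivial⇒n>1 p {{prime⇒nonTrivial p-prime}})

-- The multiplicative group of positive rationals.

ℚ⁺-*-abelianGroup : AbelianGroup _ _
ℚ⁺-*-abelianGroup = record
  { Carrier = ℚ⁺
  ; _≈_     = λ p q → proj₁ p ≡ proj₁ q
  ; _∙_     = _*⁺_
  ; ε       = ℚ.1ℚ , _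
  ; _⁻¹     = λ { (p , p>0) → (ℚ.1/ p) {{ℚ.pos⇒nonZero p {{p>0}}}} , ℚ.1/pos⇒pos p {{p>0}} }
  ; isAbelianGroup = record
    { isGroup = record
      { isMonoid = record
        { isSemigroup = record
          { isMagma = Magma.isMagma ℚ⁺-*-magma
          ; assoc   = λ p q r → ℚ.*-assoc (proj₁ p) (proj₁ q) (proj₁ r)
          }
        ; identity = (λ p → ℚ.*-identityˡ (proj₁ p)) , (λ p → ℚ.*-identityʳ (proj₁ p))
        }
      ; inverse = (λ { (p , p>0) → ℚ.*-inverseˡ p {{ℚ.pos⇒nonZero p {{p>0}}}} })
                , (λ { (p , p>0) → ℚ.*-inverseʳ p {{ℚ.pos⇒nonZero p {{p>0}}}} })
      ; ⁻¹-cong = λ { {p , _} {.p , _} refl → refl }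
      }
    ; comm = λ p q → ℚ.*-comm (proj₁ p) (proj₁ q)
    }
  }

square-mono-< : ∀ {p q} → ℚ.Positive p → ℚ.Positive q → p ℚ.< q → p ℚ.* p ℚ.< q ℚ.* q
square-mono-< {p} {q} p>0 q>0 p<q =
  ℚ.<-trans (ℚ.*-monoʳ-<-pos p {{p>0}} p<q) (ℚ.*-monoˡ-<-pos q {{q>0}} p<q)

-- Squaring is strictly increasing on the positive rationals.
ℚ⁺-uniqueRoots : UniqueRoots ℚ⁺-*-abelianGroup
ℚ⁺-uniqueRoots (p , p>0) (q , q>0) pp≡qq with ℚ.<-cmp p q
... | tri< p<q _ _ = contradiction pp≡qq (ℚ.<⇒≢ (square-mono-< p>0 q>0 p<q))
... | tri≈ _ p≡q _ = p≡q
... | tri> _ _ q<p = contradiction (sym pp≡qq) (ℚ.<⇒≢ (square-mono-< q>0 p>0 q<p))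

-- Written with `ℚ.mkℚ` so that the numerator `p` and the denominator 1 are available by
-- computation.
fromℕ : ℕ → ℚ
fromℕ p = ℚ.mkℚ (ℤ.+ p) 0 (Coprime.sym (1-coprimeTo p))

-- Among unnormalised rationals the equation is a cross-multiplied identity of integers, free of
-- reduction to lowest terms; absolute values bring it to the natural numbers.
clear-denominators : ∀ b z p → z ℚ.* z ≡ b ℚ.* fromℕ p →
                     p * ℤ.∣ ↥ b ∣ * (↧ₙ z * ↧ₙ z) ≡ ↧ₙ b * (ℤ.∣ ↥ z ∣ * ℤ.∣ ↥ z ∣)
clear-denominators b@record{} z@record{} p eq with ℚᵘ.≃-trans (ℚᵘ.≃-sym (ℚ.toℚᵘ-homo-* z z))
  (ℚᵘ.≃-trans (ℚ.toℚᵘ-cong eq) (ℚ.toℚᵘ-homo-* b (fromℕ p)))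
... | ℚᵘ.*≡* eqᶻ = begin
  p * nb * (dz * dz)                         ≡⟨ cong (_* (dz * dz)) (*-comm p nb) ⟩
  nb * p * (dz * dz)                         ≡⟨ cong (_* (dz * dz)) (ℤ.abs-* (↥ b) (ℤ.+ p)) ⟨
  ℤ.∣ ↥ b ℤ.* ℤ.+ p ∣ * (dz * dz)            ≡⟨ ℤ.abs-* (↥ b ℤ.* ℤ.+ p) (ℤ.+ (dz * dz)) ⟨
  ℤ.∣ ↥ b ℤ.* ℤ.+ p ℤ.* ℤ.+ (dz * dz) ∣      ≡⟨ cong ℤ.∣_∣ eqᶻ ⟨
  ℤ.∣ ↥ z ℤ.* ↥ z ℤ.* ℤ.+ (↧ₙ b * 1) ∣       ≡⟨ ℤ.abs-* (↥ z ℤ.* ↥ z) (ℤ.+ (↧ₙ b * 1)) ⟩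
  ℤ.∣ ↥ z ℤ.* ↥ z ∣ * (↧ₙ b * 1)             ≡⟨ cong₂ _*_ (ℤ.abs-* (↥ z) (↥ z)) (*-identityʳ (↧ₙ b)) ⟩
  nz * nz * ↧ₙ b                             ≡⟨ *-comm (nz * nz) (↧ₙ b) ⟩
  ↧ₙ b * (nz * nz)                           ∎
  where
  open ≡-Reasoning
  nb = ℤ.∣ ↥ b ∣
  nz = ℤ.∣ ↥ z ∣
  dz = ↧ₙ z

∣↥∣-nonZero : (b : ℚ⁺) → NonZero ℤ.∣ ↥ proj₁ b ∣
∣↥∣-nonZero (ℚ.mkℚ (ℤ.+ suc _) _ _ , _) = _

fromℕ-positive : ∀ p → .{{NonZero p}} → ℚ.Positive (fromℕ p)
fromℕ-positive (suc _) = _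

ℚ⁺-infiniteSquareIndex : InfiniteSquareIndex ℚ⁺-*-abelianGroup
ℚ⁺-infiniteSquareIndex b =
  -- A prime dividing no product of a numerator and its denominator divides neither of them.
  let p , p-prime , p∤ = prime-avoiding (tabulate height) (All.tabulate⁺ height≢0)
  in (fromℕ p , fromℕ-positive p {{prime⇒nonZero p-prime}}) , λ { i ((z , _) , zz≡bp) →
     let p∤height = All.tabulate⁻ p∤ i
     -- The numerator `num i` takes the place of `d`, and the denominator `den i` that of `n`.
     in p·d·t²≢n·s² p-prime (p∤height ∘ ∣m⇒∣m*n (den i)) (p∤height ∘ ∣n⇒∣m*n (num i)) ℤ.∣ ↥ z ∣ (↧ₙ z)
          (clear-denominators (proj₁ (b i)) z p zz≡bp) }
  where
  num den height : Fin _ → ℕ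
  num i = ℤ.∣ ↥ proj₁ (b i) ∣
  den i = ↧ₙ (proj₁ (b i))
  height i = num i * den i
  height≢0 : ∀ i → NonZero (height i)
  height≢0 i = m*n≢0 (num i) (den i) {{∣↥∣-nonZero (b i)}}

corollary3p7 : ¬ FAPresentable (graphStructure ℚ⁺-*-magma)
corollary3p7 = ¬FAPresentable ℚ⁺-*-abelianGroup ℚ⁺-uniqueRoots ℚ⁺-infiniteSquareIndex
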